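{- Let $a_0,a_2,b_0,b_1,b_2,\mu$ be indeterminates, $\mathbf{x}=(a_0,a_2,b_0,b_1,b_2,\mu)$. Let $[T_{n,k}]_{n,k\ge0}$ satisfy $T_{0,0}=1$, $T_{n,k}=0$ unless $0\le k\le n$, and for $n\ge1$ $$T_{n,k}=(a_0n-\mu b_1k+a_2)T_{n-1,k}+(b_0n+b_1k+b_2)T_{n-1,k-1}.$$ Let $T_n(q)=\sum_{k\ge0}T_{n,k}q^k$. Then $(T_n(\mu))_{n\ge0}$ is an $\mathbf{x}$-Stieltjes moment sequence.
   Context: For indeterminates $\mathbf{x}$, a matrix is $\mathbf{x}$-totally positive if every minor is a polynomial in $\mathbf{x}$ with nonnegative coefficients; a sequence is an $\mathbf{x}$-Stieltjes moment sequence if its Hankel matrix $[\alpha_{i+j}]_{i,j\ge0}$ is $\mathbf{x}$-totally positive. -}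

module Defs where

open import Data.Nat as ℕ using (ℕ; zero; suc)
import Data.Nat.Properties as ℕP
open import Data.Integer as ℤ using (ℤ; +_; 0ℤ; 1ℤ; -1ℤ)
open import Data.Fin as Fin using (Fin; zero; suc; toℕ; punchIn)
open import Data.Vec as Vec using (Vec; []; _∷_; replicate; zipWith)
open import Data.Vec.Properties using (≡-dec)
open import Data.List as List using (List; []; _∷_; _++_; concatMap; map)
open import Data.Product using (_×_; _,_)
open import Relation.Nullary using (yes; no)

-- Number of indeterminates: x = (a0, a2, b0, b1, b2, μ), indexed by Fin 6.
Monomial : Set
Monomial = Vec ℕ 6

-- A polynomial in Z[x], represented as a (not necessarily normalised)
-- formal sum of terms  c · x^m.  Its actual value is given by `coeff`.
Poly : Set
Poly = List (ℤ × Monomial)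

coeff : Poly → Monomial → ℤ
coeff []            m = 0ℤ
coeff ((c , e) ∷ p) m with ≡-dec ℕP._≟_ e m
... | yes _ = c ℤ.+ coeff p m
... | no  _ = coeff p m

const : ℤ → Poly
const c = (c , replicate 6 0) ∷ []

unitVec : Fin 6 → Monomial
unitVec zero    = 1 ∷ replicate 5 0
unitVec (suc i) = 0 ∷ unitVecAux i
  where
  unitVecAux : Fin 5 → Vec ℕ 5
  unitVecAux zero = 1 ∷ replicate 4 0
  unitVecAux (suc zero) = 0 ∷ 1 ∷ replicate 3 0
  unitVecAux (suc (suc zero)) = 0 ∷ 0 ∷ 1 ∷ 0 ∷ 0 ∷ []
  unitVecAux (suc (suc (suc zero))) = 0 ∷ 0 ∷ 0 ∷ 1 ∷ 0 ∷ []
  unitVecAux (suc (suc (suc (suc zero)))) = 0 ∷ 0 ∷ 0 ∷ 0 ∷ 1 ∷ []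

var : Fin 6 → Poly
var i = (1ℤ , unitVec i) ∷ []

infixl 6 _⊕_ _⊖_
infixl 7 _⊗_

_⊕_ : Poly → Poly → Poly
p ⊕ q = p ++ q

neg : Poly → Poly
neg = map (λ { (c , e) → (ℤ.- c , e) })

_⊖_ : Poly → Poly → Poly
p ⊖ q = p ⊕ neg q

_⊗_ : Poly → Poly → Poly
p ⊗ q = concatMap (λ { (c , e) → map (λ { (d , f) → (c ℤ.* d , zipWith ℕ._+_ e f) }) q }) p

zeroP : Poly
zeroP = []

oneP : Poly
oneP = const 1ℤ

natP : ℕ → Poly
natP n = const (+ n)

_^P_ : Poly → ℕ → Poly
p ^P zero  = oneP
p ^P suc n = p ⊗ (p ^P n)

a₀ a₂ b₀ b₁ b₂ μ : Poly
a₀ = var zero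
a₂ = var (suc zero)
b₀ = var (suc (suc zero))
b₁ = var (suc (suc (suc zero)))
b₂ = var (suc (suc (suc (suc zero))))
μ  = var (suc (suc (suc (suc (suc zero)))))

NonNeg : Poly → Set
NonNeg p = ∀ m → 0ℤ ℤ.≤ coeff p m

sumP : ℕ → (ℕ → Poly) → Poly
sumP zero    f = zeroP
sumP (suc n) f = sumP n f ⊕ f n

sumFin : ∀ {k} → (Fin k → Poly) → Poly
sumFin {zero}  f = zeroP
sumFin {suc k} f = f zero ⊕ sumFin (λ j → f (suc j))

signP : ℕ → Poly → Poly
signP zero          p = p
signP (suc zero)    p = neg p
signP (suc (suc n)) p = signP n p

det : ∀ {k} → (Fin k → Fin k → Poly) → Poly
det {zero}  M = oneP
det {suc k} M = sumFin (λ j → signP (toℕ j) (M zero j ⊗ det (λ r c → M (suc r) (punchIn j c))))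

StrictlyIncreasing : ∀ {k} → (Fin k → ℕ) → Set
StrictlyIncreasing {k} r = ∀ (i j : Fin k) → i Fin.< j → r i ℕ.< r j

TotallyPositive : (ℕ → ℕ → Poly) → Set
TotallyPositive A =
  ∀ (k : ℕ) (r c : Fin k → ℕ) → StrictlyIncreasing r → StrictlyIncreasing c →
  NonNeg (det (λ i j → A (r i) (c j)))

Hankel : (ℕ → Poly) → ℕ → ℕ → Poly
Hankel α i j = α (i ℕ.+ j)

StieltjesMoment : (ℕ → Poly) → Set
StieltjesMoment α = TotallyPositive (Hankel α)

T : ℕ → ℕ → Poly
T zero    zero    = oneP
T zero    (suc k) = zeroP
T (suc n) zero    = (a₀ ⊗ natP (suc n) ⊕ a₂) ⊗ T n zero
T (suc n) (suc k) =
    (a₀ ⊗ natP (suc n) ⊖ μ ⊗ b₁ ⊗ natP (suc k) ⊕ a₂) ⊗ T n (suc k)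
  ⊕ (b₀ ⊗ natP (suc n) ⊕ b₁ ⊗ natP (suc k) ⊕ b₂) ⊗ T n k

-- T_n(q) evaluated at q = μ : sum_{k=0}^{n} T_{n,k} μ^k  (T_{n,k} = 0 for k > n)
Tμ : ℕ → Poly
Tμ n = sumP (suc n) (λ k → T n k ⊗ (μ ^P k))

{-# OPTIONS --safe #-}
-- At q = μ the terms in k cancel, so that T_n(μ) = (x n + y) T_{n-1}(μ) with x = a₀ + μ b₀ and
-- y = a₂ + μ (b₁ + b₂); hence T_n(μ) = c (c + x) ⋯ (c + (n-1) x) with c = x + y.
--
-- Adding a nonnegative multiple of a neighbouring row to a row (and scaling a row) turns each minor
-- into a nonnegative combination of minors: when the new row index is already selected, two adjacent
-- rows are equal and that term vanishes. Neville elimination reaches the Hankel matrix of the rising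
-- factorials by such operations from the upper triangular matrix
-- U(c)_{k,j} = x^k j(j-1)⋯(j-k+1) c(c+x)⋯(c+(j-1)x). In turn U(c) arises by such operations from
-- 1 ⊕ U(c + x), where the columns are shifted by one, so induction on a bound for the columns applies.
module Submission where

open import Defs
open import Level using (Level; _⊔_) renaming (suc to lsuc)
open import Algebra.Bundles using (CommutativeRing)
open import Algebra.Structures using (IsAbelianGroup)
import Algebra.Properties.Ring
import Algebra.Properties.Semiring.Mult
import Algebra.Properties.Semiring.Sum
import Algebra.Solver.Ring.NaturalCoefficients.Default
import Relation.Binary.Reasoning.Setoid
open import Data.Nat as ℕ using (ℕ; zero; suc; pred; z≤n; s≤s; _≤_; _<_; _⊓_; _∸_)
import Data.Nat.Properties as ℕ
open import Data.Fin as Fin using (Fin; zero; suc; toℕ; fromℕ<; inject₁; punchIn)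
open import Data.Fin.Patterns using (0F; 1F; 2F; 3F; 4F; 5F)
import Data.Fin.Properties as Fin
open import Data.Vec.Functional using (updateAt)
open import Data.Vec.Functional.Properties using (updateAt-updates; updateAt-minimal)
open import Data.Integer as ℤ using (ℤ; +_; 0ℤ; 1ℤ)
import Data.Integer.Properties as ℤ
open import Data.List as List using ([]; _∷_)
import Data.List.Properties as List
open import Data.List.Relation.Unary.All using (All; []; _∷_)
import Data.List.Relation.Unary.All.Properties as All
open import Data.Vec using (Vec; []; _∷_; replicate; zipWith)
open import Data.Vec.Properties as Vec using (≡-dec)
open import Data.Product using (∃; _×_; _,_; proj₁; proj₂)
open import Data.Sum using (_⊎_; inj₁; inj₂)
open import Function using (_∘_) renaming (const to always)
open import Relation.Nullary using (yes; no; contradiction)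
open import Relation.Binary using (Setoid; tri<; tri≈; tri>)
open import Relation.Binary.PropositionalEquality as ≡ using (_≡_; _≢_)

-- Index combinatorics: column deletions and strictly increasing selections

punchIn-suc : ∀ {n} (i l : Fin (suc n)) → toℕ i ≤ toℕ l → punchIn (inject₁ i) l ≡ suc l
punchIn-suc zero l _ = ≡.refl
punchIn-suc {suc n} (suc i) (suc l) (s≤s i≤l) = ≡.cong suc (punchIn-suc i l i≤l)

punchIn-inject₁ : ∀ {n} (i l : Fin (suc n)) → toℕ i ≤ toℕ l → punchIn (suc l) i ≡ inject₁ i
punchIn-inject₁ zero l _ = ≡.refl
punchIn-inject₁ {suc n} (suc i) (suc l) (s≤s i≤l) = ≡.cong suc (punchIn-inject₁ i l i≤l)

-- The cosimplicial identity: deleting two columns in either order leaves the same columns.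
punchIn-punchIn : ∀ {n} (i l : Fin (suc n)) (c : Fin n) → toℕ i ≤ toℕ l →
  punchIn (inject₁ i) (punchIn l c) ≡ punchIn (suc l) (punchIn i c)
punchIn-punchIn zero l c _ = ≡.refl
punchIn-punchIn (suc i) (suc l) zero _ = ≡.refl
punchIn-punchIn (suc i) (suc l) (suc c) (s≤s i≤l) = ≡.cong suc (punchIn-punchIn i l c i≤l)

strictlyIncreasing-injective : ∀ {k} {r : Fin k → ℕ} → StrictlyIncreasing r →
  ∀ {i j} → r i ≡ r j → i ≡ j
strictlyIncreasing-injective r↑ {i} {j} eq with Fin.<-cmp i j
... | tri< i<j _ _ = contradiction eq (ℕ.<⇒≢ (r↑ i j i<j))
... | tri≈ _ i≡j _ = i≡j
... | tri> _ _ j<i = contradiction (≡.sym eq) (ℕ.<⇒≢ (r↑ j i j<i))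

-- Were there an index strictly between, the one after `p` would take a value strictly between `r p`
-- and its successor.
strictlyIncreasing-consecutive : ∀ {k} {r : Fin k → ℕ} → StrictlyIncreasing r →
  ∀ p q → r q ≡ suc (r p) → toℕ q ≡ suc (toℕ p)
strictlyIncreasing-consecutive {r = r} r↑ p q eq with ℕ.<-cmp (suc (toℕ p)) (toℕ q)
... | tri≈ _ p+1≡q _ = ≡.sym p+1≡q
... | tri> _ _ (s≤s q≤p) with Fin.<-cmp q p
...   | tri< q<p _ _ = contradiction (r↑ q p q<p) (ℕ.≤⇒≯ (ℕ.≤-trans (ℕ.n≤1+n _) (ℕ.≤-reflexive (≡.sym eq))))
...   | tri≈ _ ≡.refl _ = contradiction (≡.sym eq) ℕ.1+n≢n
...   | tri> _ _ p<q = contradiction p<q (ℕ.≤⇒≯ q≤p)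
strictlyIncreasing-consecutive {r = r} r↑ p q eq | tri< p+1<q _ _ =
  contradiction (ℕ.<-≤-trans rs<rq (ℕ.≤-reflexive eq)) (ℕ.≤⇒≯ rp<rs)
  where
  p+1<k : suc (toℕ p) < _
  p+1<k = ℕ.<-trans p+1<q (Fin.toℕ<n q)
  s = fromℕ< p+1<k
  rp<rs : r p < r s
  rp<rs = r↑ p s (ℕ.≤-reflexive (≡.sym (Fin.toℕ-fromℕ< p+1<k)))
  rs<rq : r s < r q
  rs<rq = r↑ s q (≡.subst (_< toℕ q) (≡.sym (Fin.toℕ-fromℕ< p+1<k)) p+1<q)

strictlyIncreasing-pred : ∀ {k} {r : Fin k → ℕ} → (∀ i → 0 < r i) →
  StrictlyIncreasing r → StrictlyIncreasing (pred ∘ r)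
strictlyIncreasing-pred {r = r} r>0 r↑ i j i<j with r i | r j | r>0 i | r↑ i j i<j
... | suc _ | suc _ | _ | s≤s lt = lt

strictlyIncreasing-tail : ∀ {k} {r : Fin (suc k) → ℕ} →
  StrictlyIncreasing r → StrictlyIncreasing (r ∘ suc)
strictlyIncreasing-tail r↑ i j i<j = r↑ (suc i) (suc j) (s≤s i<j)

tail-positive : ∀ {k} {r : Fin (suc k) → ℕ} → StrictlyIncreasing r → ∀ i → 0 < r (suc i)
tail-positive r↑ i = ℕ.≤-<-trans z≤n (r↑ zero (suc i) (s≤s z≤n))

head-positive⇒positive : ∀ {k} {r : Fin (suc k) → ℕ} → StrictlyIncreasing r →
  0 < r zero → ∀ i → 0 < r i
head-positive⇒positive r↑ 0<r₀ zero    = 0<r₀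
head-positive⇒positive r↑ 0<r₀ (suc i) = tail-positive r↑ i

Neighbours : ℕ → ℕ → Set
Neighbours m n = n ≡ suc m ⊎ m ≡ suc n

neighbour-below : ∀ {m n i} → Neighbours m n → i < m → i ≢ n → i < n
neighbour-below (inj₁ ≡.refl) i<m _ = ℕ.m<n⇒m<1+n i<m
neighbour-below (inj₂ ≡.refl) (s≤s i≤n) i≢n = ℕ.≤∧≢⇒< i≤n i≢n

neighbour-above : ∀ {m n i} → Neighbours m n → m < i → i ≢ n → n < i
neighbour-above (inj₁ ≡.refl) m<i i≢n = ℕ.≤∧≢⇒< m<i (i≢n ∘ ≡.sym)
neighbour-above (inj₂ ≡.refl) m<i _ = ℕ.<-trans (ℕ.n<1+n _) m<i

neighbours-distinct : ∀ {k} {p q : Fin k} → Neighbours (toℕ p) (toℕ q) → q ≢ p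
neighbours-distinct (inj₁ eq) ≡.refl = ℕ.1+n≢n (≡.sym eq)
neighbours-distinct (inj₂ eq) ≡.refl = ℕ.1+n≢n (≡.sym eq)

strictlyIncreasing-neighbours : ∀ {k} {r : Fin k → ℕ} → StrictlyIncreasing r →
  ∀ p q → Neighbours (r p) (r q) → Neighbours (toℕ p) (toℕ q)
strictlyIncreasing-neighbours r↑ p q (inj₁ eq) = inj₁ (strictlyIncreasing-consecutive r↑ p q eq)
strictlyIncreasing-neighbours r↑ p q (inj₂ eq) = inj₂ (strictlyIncreasing-consecutive r↑ q p eq)

strictlyIncreasing-updateAt : ∀ {k} {r : Fin k → ℕ} → StrictlyIncreasing r →
  ∀ p n → Neighbours (r p) n → (∀ i → r i ≢ n) → StrictlyIncreasing (updateAt r p (always n))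
strictlyIncreasing-updateAt {r = r} r↑ p n rp~n n∉r i j i<j with i Fin.≟ p | j Fin.≟ p
... | yes ≡.refl | yes ≡.refl = contradiction i<j (ℕ.<-irrefl ≡.refl)
... | yes ≡.refl | no j≢p
  rewrite updateAt-updates p {f = always n} r | updateAt-minimal j p {f = always n} r j≢p
  = neighbour-above rp~n (r↑ i j i<j) (n∉r j)
... | no i≢p | yes ≡.refl
  rewrite updateAt-updates p {f = always n} r | updateAt-minimal i p {f = always n} r i≢p
  = neighbour-below rp~n (r↑ i j i<j) (n∉r i)
... | no i≢p | no j≢p
  rewrite updateAt-minimal i p {f = always n} r i≢p | updateAt-minimal j p {f = always n} r j≢p
  = r↑ i j i<j

bounded : ∀ {k} (r : Fin k → ℕ) → ∃ λ s → ∀ i → r i < s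
bounded {zero}  r = 0 , λ ()
bounded {suc k} r with bounded (r ∘ suc)
... | s , r<s = suc (r zero) ℕ.⊔ s , λ where
  zero    → ℕ.m≤m⊔n (suc (r zero)) s
  (suc i) → ℕ.≤-trans (r<s i) (ℕ.m≤n⊔m (suc (r zero)) s)

-- Stages `s` and `s + 1` can differ in row `s` only, so a transformation of all rows splits into
-- single row operations.
stage : ∀ {a} {A : Set a} → (ℕ → A) → (ℕ → A) → ℕ → ℕ → A
stage B C zero    m       = B m
stage B C (suc s) zero    = C zero
stage B C (suc s) (suc m) = stage (B ∘ suc) (C ∘ suc) s m

module _ {a} {A : Set a} where

  stage-< : ∀ (B C : ℕ → A) {s m} → m < s → stage B C s m ≡ C m
  stage-< B C {suc s} {zero}  _         = ≡.refl
  stage-< B C {suc s} {suc m} (s≤s m<s) = stage-< (B ∘ suc) (C ∘ suc) m<s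

  stage-≥ : ∀ (B C : ℕ → A) {s m} → s ≤ m → stage B C s m ≡ B m
  stage-≥ B C {zero}  {m}     _         = ≡.refl
  stage-≥ B C {suc s} {suc m} (s≤s s≤m) = stage-≥ (B ∘ suc) (C ∘ suc) s≤m

  stage-suc : ∀ (B C : ℕ → A) {s m} → m ≢ s → stage B C (suc s) m ≡ stage B C s m
  stage-suc B C {s} {m} m≢s with ℕ.<-cmp m s
  ... | tri< m<s _ _ = ≡.trans (stage-< B C (ℕ.m<n⇒m<1+n m<s)) (≡.sym (stage-< B C m<s))
  ... | tri≈ _ m≡s _ = contradiction m≡s m≢s
  ... | tri> _ _ s<m = ≡.trans (stage-≥ B C s<m) (≡.sym (stage-≥ B C (ℕ.<⇒≤ s<m)))

-- Determinants over a commutative ring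

module Determinant {a ℓ : Level} (R : CommutativeRing a ℓ) where
  open CommutativeRing R hiding (zero)
  open Algebra.Properties.Ring ring using (-‿distribˡ-*)
  open Algebra.Properties.Semiring.Sum semiring
  open Algebra.Solver.Ring.NaturalCoefficients.Default commutativeSemiring
  open Relation.Binary.Reasoning.Setoid setoid

  Matrix : ℕ → Set a
  Matrix k = Fin k → Fin k → Carrier

  sgn : ℕ → Carrier
  sgn zero    = 1#
  sgn (suc n) = - sgn n

  minor : ∀ {k} → Matrix (suc k) → Fin (suc k) → Matrix k
  minor M j r c = M (suc r) (punchIn j c)

  determinant : ∀ {k} → Matrix k → Carrier
  determinant {zero}  M = 1#
  determinant {suc k} M = sum (λ j → sgn (toℕ j) * (M zero j * determinant (minor M j)))

  sum-zero : ∀ {n} {f : Fin n → Carrier} → (∀ i → f i ≈ 0#) → sum f ≈ 0#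
  sum-zero {n} f≈0 = trans (sum-cong-≋ f≈0) (sum-replicate-zero n)

  sum-linear : ∀ {n} α β {f g h : Fin n → Carrier} → (∀ i → f i ≈ α * g i + β * h i) →
    sum f ≈ α * sum g + β * sum h
  sum-linear α β {f} {g} {h} eq = begin
    sum f                                          ≈⟨ sum-cong-≋ eq ⟩
    sum (λ i → α * g i + β * h i)                  ≈⟨ ∑-distrib-+ (λ i → α * g i) (λ i → β * h i) ⟩
    sum (λ i → α * g i) + sum (λ i → β * h i)      ≈⟨ +-cong (*-distribˡ-sum α g) (*-distribˡ-sum β h) ⟨
    α * sum g + β * sum h                          ∎

  determinant-cong : ∀ {k} {M N : Matrix k} → (∀ i j → M i j ≈ N i j) →
    determinant M ≈ determinant N
  determinant-cong {zero}  eq = refl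
  determinant-cong {suc k} eq = sum-cong-≋ λ j →
    *-congˡ {sgn (toℕ j)} (*-cong (eq zero j) (determinant-cong (λ r c → eq (suc r) (punchIn j c))))

  -- Expand along row 0: for `p = 0` its entries split, otherwise the minors do, by induction.
  -- Agreement off row `p` is a hypothesis, so that the lemma applies directly to submatrices with
  -- one row index replaced.
  determinant-linear : ∀ {k} (p : Fin k) α β {M A B : Matrix k} →
    (∀ i → i ≢ p → ∀ j → M i j ≈ A i j) →
    (∀ i → i ≢ p → ∀ j → M i j ≈ B i j) →
    (∀ j → M p j ≈ α * A p j + β * B p j) →
    determinant M ≈ α * determinant A + β * determinant B
  determinant-linear {suc k} zero α β {M} {A} {B} M≈A M≈B Mₚ = sum-linear α β λ j → begin
    sgn (toℕ j) * (M zero j * determinant (minor M j))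
      ≈⟨ *-congˡ (*-congʳ (Mₚ j)) ⟩
    sgn (toℕ j) * ((α * A zero j + β * B zero j) * determinant (minor M j))
      ≈⟨ solve 6 (λ s α β x y d →
           s :* ((α :* x :+ β :* y) :* d) := α :* (s :* (x :* d)) :+ β :* (s :* (y :* d)))
           refl (sgn (toℕ j)) α β (A zero j) (B zero j) (determinant (minor M j)) ⟩
    α * (sgn (toℕ j) * (A zero j * determinant (minor M j))) +
    β * (sgn (toℕ j) * (B zero j * determinant (minor M j)))
      ≈⟨ +-cong
           (*-congˡ (*-congˡ (*-congˡ (determinant-cong λ r c → M≈A (suc r) (λ ()) (punchIn j c)))))
           (*-congˡ (*-congˡ (*-congˡ (determinant-cong λ r c → M≈B (suc r) (λ ()) (punchIn j c))))) ⟩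
    α * (sgn (toℕ j) * (A zero j * determinant (minor A j))) +
    β * (sgn (toℕ j) * (B zero j * determinant (minor B j))) ∎
  determinant-linear {suc k} (suc p) α β {M} {A} {B} M≈A M≈B Mₚ = sum-linear α β λ j → begin
    sgn (toℕ j) * (M zero j * determinant (minor M j))
      ≈⟨ *-congˡ (*-congˡ (determinant-linear p α β
           (λ i i≢p c → M≈A (suc i) (i≢p ∘ Fin.suc-injective) (punchIn j c))
           (λ i i≢p c → M≈B (suc i) (i≢p ∘ Fin.suc-injective) (punchIn j c))
           (λ c → Mₚ (punchIn j c)))) ⟩
    sgn (toℕ j) * (M zero j * (α * determinant (minor A j) + β * determinant (minor B j)))
      ≈⟨ solve 6 (λ s α β m x y →
           s :* (m :* (α :* x :+ β :* y)) := α :* (s :* (m :* x)) :+ β :* (s :* (m :* y)))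
           refl (sgn (toℕ j)) α β (M zero j) (determinant (minor A j)) (determinant (minor B j)) ⟩
    α * (sgn (toℕ j) * (M zero j * determinant (minor A j))) +
    β * (sgn (toℕ j) * (M zero j * determinant (minor B j)))
      ≈⟨ +-cong (*-congˡ (*-congˡ (*-congʳ (M≈A zero (λ ()) j))))
                (*-congˡ (*-congˡ (*-congʳ (M≈B zero (λ ()) j)))) ⟩
    α * (sgn (toℕ j) * (A zero j * determinant (minor A j))) +
    β * (sgn (toℕ j) * (B zero j * determinant (minor B j))) ∎

  -- G j l stands for the term that deletes column j and then the l-th of the remaining columns;
  -- for i ≤ l the two terms below delete the same pair of columns, in the two possible orders.
  antisymmetric-sum : ∀ {n} (G : Fin (suc n) → Fin n → Carrier) →
    (∀ i l → toℕ i ≤ toℕ l → G (inject₁ i) l + G (suc l) i ≈ 0#) →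
    sum (λ j → sum (G j)) ≈ 0#
  antisymmetric-sum {zero} G _ = +-identityˡ 0#
  antisymmetric-sum {suc n} G anti = begin
    sum (G zero) + sum (λ j → G (suc j) zero + sum (λ l → G (suc j) (suc l)))
      ≈⟨ +-congˡ (∑-distrib-+ (λ j → G (suc j) zero) (λ j → sum (λ l → G (suc j) (suc l)))) ⟩
    sum (G zero) + (sum (λ j → G (suc j) zero) + sum (λ j → sum (λ l → G (suc j) (suc l))))
      ≈⟨ +-assoc _ _ _ ⟨
    sum (G zero) + sum (λ j → G (suc j) zero) + sum (λ j → sum (λ l → G (suc j) (suc l)))
      ≈⟨ +-cong (∑-distrib-+ (G zero) (λ j → G (suc j) zero)) refl ⟨
    sum (λ j → G zero j + G (suc j) zero) + sum (λ j → sum (λ l → G (suc j) (suc l)))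
      ≈⟨ +-cong (sum-zero (λ j → anti zero j z≤n))
           (antisymmetric-sum (λ j l → G (suc j) (suc l)) (λ i l i≤l → anti (suc i) (suc l) (s≤s i≤l))) ⟩
    0# + 0#
      ≈⟨ +-identityˡ 0# ⟩
    0# ∎

  swap-cancels : ∀ s t x y d → s * (x * (t * (y * d))) + (- t) * (y * (s * (x * d))) ≈ 0#
  swap-cancels s t x y d = begin
    s * (x * (t * (y * d))) + (- t) * (y * (s * (x * d)))
      ≈⟨ +-cong
           (solve 5 (λ s t x y d → s :* (x :* (t :* (y :* d))) := t :* (y :* (s :* (x :* d))))
             refl s t x y d)
           (sym (-‿distribˡ-* t _)) ⟩
    t * (y * (s * (x * d))) + - (t * (y * (s * (x * d))))
      ≈⟨ -‿inverseʳ _ ⟩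
    0# ∎

  -- For rows 0 and 1, a double expansion is a sum over ordered pairs of columns, and exchanging a
  -- pair only changes the sign. A later pair of equal rows survives in every minor of the expansion
  -- along row 0.
  determinant-adjacent-equal : ∀ {k} (p q : Fin k) → toℕ q ≡ suc (toℕ p) → (M : Matrix k) →
    (∀ j → M p j ≈ M q j) → determinant M ≈ 0#
  determinant-adjacent-equal zero (suc zero) _ M M₀≈M₁ =
    trans (sum-cong-≋ expand) (antisymmetric-sum G G-antisymmetric)
    where
    D = λ j l → determinant (minor (minor M j) l)
    G′ = λ j l → sgn (toℕ l) * (M (suc zero) (punchIn j l) * D j l)
    G = λ j l → sgn (toℕ j) * (M zero j * G′ j l)
    expand : ∀ j → sgn (toℕ j) * (M zero j * determinant (minor M j)) ≈ sum (G j)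
    expand j = begin
      sgn (toℕ j) * (M zero j * sum (G′ j))
        ≈⟨ *-congˡ (*-distribˡ-sum (M zero j) (G′ j)) ⟩
      sgn (toℕ j) * sum (λ l → M zero j * G′ j l)
        ≈⟨ *-distribˡ-sum (sgn (toℕ j)) (λ l → M zero j * G′ j l) ⟩
      sum (G j) ∎
    G-antisymmetric : ∀ i l → toℕ i ≤ toℕ l → G (inject₁ i) l + G (suc l) i ≈ 0#
    -- After rewriting, both terms involve the columns `inject₁ i` and `suc l`, and `sgn` of `suc l`
    -- is `- sgn` of `l`.
    G-antisymmetric i l i≤l
      rewrite Fin.toℕ-inject₁ i | punchIn-suc i l i≤l | punchIn-inject₁ i l i≤l = begin
      sgn (toℕ i) * (M zero (inject₁ i) * (sgn (toℕ l) * (M (suc zero) (suc l) * D (inject₁ i) l))) +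
      (- sgn (toℕ l)) * (M zero (suc l) * (sgn (toℕ i) * (M (suc zero) (inject₁ i) * D (suc l) i)))
        ≈⟨ +-cong
             (*-congˡ (*-congˡ (*-congˡ (*-cong (sym (M₀≈M₁ (suc l)))
               (determinant-cong λ r c → reflexive (≡.cong (M (suc (suc r))) (punchIn-punchIn i l c i≤l)))))))
             (*-congˡ (*-congˡ (*-congˡ (*-congʳ (sym (M₀≈M₁ (inject₁ i))))))) ⟩
      sgn (toℕ i) * (M zero (inject₁ i) * (sgn (toℕ l) * (M zero (suc l) * D (suc l) i))) +
      (- sgn (toℕ l)) * (M zero (suc l) * (sgn (toℕ i) * (M zero (inject₁ i) * D (suc l) i)))
        ≈⟨ swap-cancels (sgn (toℕ i)) (sgn (toℕ l)) (M zero (inject₁ i)) (M zero (suc l)) (D (suc l) i) ⟩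
      0# ∎
  determinant-adjacent-equal {suc k} (suc p) (suc q) q≡p+1 M Mₚ≈M_q = sum-zero λ j → begin
    sgn (toℕ j) * (M zero j * determinant (minor M j))
      ≈⟨ *-congˡ (*-congˡ (determinant-adjacent-equal p q (ℕ.suc-injective q≡p+1) (minor M j)
           (λ c → Mₚ≈M_q (punchIn j c)))) ⟩
    sgn (toℕ j) * (M zero j * 0#)
      ≈⟨ *-congˡ (zeroʳ _) ⟩
    sgn (toℕ j) * 0#
      ≈⟨ zeroʳ _ ⟩
    0# ∎

  determinant-neighbours-equal : ∀ {k} (p q : Fin k) → Neighbours (toℕ p) (toℕ q) → (M : Matrix k) →
    (∀ j → M p j ≈ M q j) → determinant M ≈ 0#
  determinant-neighbours-equal p q (inj₁ eq) M Mₚ≈M_q = determinant-adjacent-equal p q eq M Mₚ≈M_q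
  determinant-neighbours-equal p q (inj₂ eq) M Mₚ≈M_q = determinant-adjacent-equal q p eq M (sym ∘ Mₚ≈M_q)

  -- In the expansion along row 0, the term of column 0 has a zero entry, and every other minor
  -- still contains the zero column.
  determinant-zero-column : ∀ {k} (M : Matrix (suc k)) → (∀ i → M i zero ≈ 0#) → determinant M ≈ 0#
  determinant-zero-column {k} M M₀≈0 = sum-zero (term M M₀≈0)
    where
    term : ∀ {k} (M : Matrix (suc k)) → (∀ i → M i zero ≈ 0#) →
      ∀ j → sgn (toℕ j) * (M zero j * determinant (minor M j)) ≈ 0#
    term M M₀≈0 zero = trans (*-congˡ (trans (*-congʳ (M₀≈0 zero)) (zeroˡ _))) (zeroʳ _)
    term {suc k} M M₀≈0 (suc j) =
      trans (*-congˡ (trans (*-congˡ (determinant-zero-column (minor M (suc j)) (M₀≈0 ∘ suc))) (zeroʳ _)))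
        (zeroʳ _)

  determinant-first-row : ∀ {k} (M : Matrix (suc k)) → (∀ j → M zero (suc j) ≈ 0#) →
    determinant M ≈ M zero zero * determinant (minor M zero)
  determinant-first-row M M₀≈0 = begin
    1# * (M zero zero * determinant (minor M zero)) +
    sum (λ j → sgn (toℕ (suc j)) * (M zero (suc j) * determinant (minor M (suc j))))
      ≈⟨ +-cong (*-identityˡ _)
           (sum-zero λ j → trans (*-congˡ (trans (*-congʳ (M₀≈0 j)) (zeroˡ _))) (zeroʳ _)) ⟩
    M zero zero * determinant (minor M zero) + 0#
      ≈⟨ +-identityʳ _ ⟩
    M zero zero * determinant (minor M zero) ∎

-- Total positivity relative to a cone in a commutative ring

record PositiveCone {a ℓ : Level} (R : CommutativeRing a ℓ) (p : Level) : Set (a ⊔ ℓ ⊔ lsuc p) where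
  open CommutativeRing R hiding (zero)
  field
    Pos      : Carrier → Set p
    Pos-resp : ∀ {u v} → u ≈ v → Pos u → Pos v
    Pos-0    : Pos 0#
    Pos-1    : Pos 1#
    Pos-+    : ∀ {u v} → Pos u → Pos v → Pos (u + v)
    Pos-*    : ∀ {u v} → Pos u → Pos v → Pos (u * v)

module Positivity {a ℓ p : Level} (R : CommutativeRing a ℓ) (cone : PositiveCone R p) where
  open CommutativeRing R hiding (zero)
  open PositiveCone cone
  open Determinant R
  open Algebra.Properties.Semiring.Mult semiring using (×-homo-+) renaming (_×_ to _×ᴿ_)
  open Algebra.Solver.Ring.NaturalCoefficients.Default commutativeSemiring
  open Relation.Binary.Reasoning.Setoid setoid

  submatrix : ∀ {k} → (ℕ → ℕ → Carrier) → (r c : Fin k → ℕ) → Matrix k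
  submatrix A r c i j = A (r i) (c j)

  -- Only columns are bounded: `TPBelow-add-next` reads one row further down, so a row bound would
  -- not be preserved. A column bound is untouched by row operations and grows by one under
  -- bordering.
  TPBelow : ℕ → (ℕ → ℕ → Carrier) → Set p
  TPBelow N A = ∀ {k} (r c : Fin k → ℕ) → StrictlyIncreasing r → StrictlyIncreasing c →
    (∀ j → c j < N) → Pos (determinant (submatrix A r c))

  TPBelow-zero : ∀ A → TPBelow 0 A
  TPBelow-zero A {zero}  r c _ _ _ = Pos-1
  TPBelow-zero A {suc k} r c _ _ c<0 = contradiction (c<0 zero) λ ()

  TPBelow-cong : ∀ {N A C} → (∀ i j → j < N → A i j ≈ C i j) → TPBelow N A → TPBelow N C
  TPBelow-cong A≈C tp r c r↑ c↑ c<N =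
    Pos-resp (determinant-cong λ i j → A≈C (r i) (c j) (c<N j)) (tp r c r↑ c↑ c<N)

  -- Linearity in row `m` leaves the minor with `n` in place of `m` to be examined. If `n` is free,
  -- the selection stays increasing; if `n` is taken, two adjacent rows coincide.
  TPBelow-neighbour : ∀ {N A C} m n {α β} → Neighbours m n → Pos α → Pos β →
    (∀ i → i ≢ m → ∀ j → C i j ≈ A i j) →
    (∀ j → C m j ≈ α * A m j + β * A n j) →
    TPBelow N A → TPBelow N C
  TPBelow-neighbour {N} {A} {C} m n {α} {β} m~n α≥0 β≥0 C≈A Cₘ tp r c r↑ c↑ c<N
    with Fin.any? (λ i → r i ℕ.≟ m)
  ... | no m∉r =
    Pos-resp (determinant-cong λ i j → sym (C≈A (r i) (λ rᵢ≡m → m∉r (i , rᵢ≡m)) (c j))) (tp r c r↑ c↑ c<N)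
  ... | yes (p , ≡.refl) =
    Pos-resp (sym (determinant-linear p α β C≈A-off C≈A′-off C≈-on))
      (Pos-+ (Pos-* α≥0 (tp r c r↑ c↑ c<N)) (Pos-* β≥0 replaced≥0))
    where
    r′ = updateAt r p (always n)
    off : ∀ i → i ≢ p → r i ≢ r p
    off i i≢p eq = i≢p (strictlyIncreasing-injective r↑ eq)
    C≈A-off : ∀ i → i ≢ p → ∀ j → C (r i) (c j) ≈ A (r i) (c j)
    C≈A-off i i≢p j = C≈A (r i) (off i i≢p) (c j)
    C≈A′-off : ∀ i → i ≢ p → ∀ j → C (r i) (c j) ≈ A (r′ i) (c j)
    C≈A′-off i i≢p j rewrite updateAt-minimal i p {f = always n} r i≢p = C≈A-off i i≢p j
    C≈-on : ∀ j → C (r p) (c j) ≈ α * A (r p) (c j) + β * A (r′ p) (c j)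
    C≈-on j rewrite updateAt-updates p {f = always n} r = Cₘ (c j)
    replaced≥0 : Pos (determinant (submatrix A r′ c))
    replaced≥0 with Fin.any? (λ i → r i ℕ.≟ n)
    ... | no n∉r =
      tp r′ c (strictlyIncreasing-updateAt r↑ p n m~n (λ i rᵢ≡n → n∉r (i , rᵢ≡n))) c↑ c<N
    ... | yes (q , ≡.refl) =
      Pos-resp (sym (determinant-neighbours-equal p q p~q (submatrix A r′ c)
        (λ j → reflexive (≡.cong (λ i → A i (c j)) r′p≡r′q)))) Pos-0
      where
      p~q = strictlyIncreasing-neighbours r↑ p q m~n
      r′p≡r′q : r′ p ≡ r′ q
      r′p≡r′q = ≡.trans (updateAt-updates p r) (≡.sym (updateAt-minimal q p r (neighbours-distinct p~q)))

  -- A fixed minor sees only finitely many rows, so from some stage on it is a minor of `C`.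
  TPBelow-stages : ∀ {N} (B C : ℕ → ℕ → Carrier) →
    (∀ s → TPBelow N (stage B C s) → TPBelow N (stage B C (suc s))) →
    TPBelow N B → TPBelow N C
  TPBelow-stages {N} B C step tp r c r↑ c↑ c<N =
    Pos-resp (determinant-cong λ i j → reflexive (≡.cong-app (stage-< B C (r<s i)) (c j)))
      (all (proj₁ (bounded r)) r c r↑ c↑ c<N)
    where
    r<s = proj₂ (bounded r)
    all : ∀ s → TPBelow N (stage B C s)
    all zero    = tp
    all (suc s) = step s (all s)

  -- Rows are replaced in increasing order, so row `s + 1` still comes from `B` when row `s` is
  -- replaced.
  TPBelow-add-next : ∀ {N B C} (α β : ℕ → Carrier) → (∀ i → Pos (α i)) → (∀ i → Pos (β i)) →
    (∀ i j → C i j ≈ α i * B i j + β i * B (suc i) j) →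
    TPBelow N B → TPBelow N C
  TPBelow-add-next {B = B} {C} α β α≥0 β≥0 C≈ = TPBelow-stages B C λ s →
    TPBelow-neighbour s (suc s) (inj₁ ≡.refl) (α≥0 s) (β≥0 s)
      (λ i i≢s j → reflexive (≡.cong-app (stage-suc B C i≢s) j))
      (row s)
    where
    row : ∀ s j → stage B C (suc s) s j ≈ α s * stage B C s s j + β s * stage B C s (suc s) j
    row s j rewrite stage-< B C (ℕ.n<1+n s) | stage-≥ B C (ℕ.≤-refl {s}) | stage-≥ B C (ℕ.n≤1+n s) = C≈ s j

  -- The order is again increasing, but row `s + 1` draws on row `s`, which has been replaced
  -- already: hence `C` in the last summand.
  TPBelow-accumulate : ∀ {N B C} (β : ℕ → Carrier) → (∀ i → Pos (β i)) →
    (∀ j → C 0 j ≈ B 0 j) →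
    (∀ i j → C (suc i) j ≈ B (suc i) j + β i * C i j) →
    TPBelow N B → TPBelow N C
  TPBelow-accumulate {N} {B} {C} β β≥0 C₀≈ C≈ = TPBelow-stages B C step
    where
    row : ∀ s j → stage B C (suc (suc s)) (suc s) j ≈
      1# * stage B C (suc s) (suc s) j + β s * stage B C (suc s) s j
    row s j rewrite stage-< B C (ℕ.n<1+n (suc s)) | stage-≥ B C (ℕ.≤-refl {suc s}) | stage-< B C (ℕ.n<1+n s) =
      trans (C≈ s j) (+-congʳ (sym (*-identityˡ _)))
    step : ∀ s → TPBelow N (stage B C s) → TPBelow N (stage B C (suc s))
    -- Row 0 has no predecessor and stays as it is; the multiplier `β s` belongs to row `s + 1`.
    step zero = TPBelow-cong {A = stage B C 0} {C = stage B C 1} λ where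
      zero    j _ → sym (C₀≈ j)
      (suc i) j _ → refl
    step (suc s) = TPBelow-neighbour (suc s) s (inj₂ ≡.refl) Pos-1 (β≥0 s)
      (λ i i≢s j → reflexive (≡.cong-app (stage-suc B C i≢s) j)) (row s)

  bordered : (ℕ → ℕ → Carrier) → ℕ → ℕ → Carrier
  bordered A zero    zero    = 1#
  bordered A zero    (suc j) = 0#
  bordered A (suc i) zero    = 0#
  bordered A (suc i) (suc j) = A i j

  bordered-pred : ∀ A {i j} → 0 < i → 0 < j → A (pred i) (pred j) ≡ bordered A i j
  bordered-pred A {suc i} {suc j} _ _ = ≡.refl

  bordered-zeroʳ : ∀ A {i j} → i ≡ 0 → 0 < j → bordered A i j ≡ 0#
  bordered-zeroʳ A {j = suc j} ≡.refl _ = ≡.refl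

  bordered-zeroˡ : ∀ A {i j} → 0 < i → j ≡ 0 → bordered A i j ≡ 0#
  bordered-zeroˡ A {i = suc i} _ ≡.refl = ≡.refl

  bordered-positive-indices : ∀ {N A k} (r c : Fin k → ℕ) → TPBelow N A →
    StrictlyIncreasing r → StrictlyIncreasing c → (∀ i → 0 < r i) → (∀ j → 0 < c j) →
    (∀ j → c j < suc N) → Pos (determinant (submatrix (bordered A) r c))
  bordered-positive-indices {N} {A} r c tp r↑ c↑ r>0 c>0 c≤N =
    Pos-resp (determinant-cong λ i j → reflexive (bordered-pred A (r>0 i) (c>0 j)))
      (tp (pred ∘ r) (pred ∘ c) (strictlyIncreasing-pred r>0 r↑) (strictlyIncreasing-pred c>0 c↑)
        (λ j → pred-< (c>0 j) (c≤N j)))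
    where
    pred-< : ∀ {m} → 0 < m → m < suc N → pred m < N
    pred-< {suc m} _ (s≤s m<N) = m<N

  -- Without row and column 0, the minor is one of `A`. With column 0 but not row 0, a column
  -- vanishes. With row 0, only the corner of the first row can be nonzero, and the minor is that
  -- corner times a minor of `A`.
  TPBelow-bordered : ∀ {N A} → TPBelow N A → TPBelow (suc N) (bordered A)
  TPBelow-bordered tp {zero} r c _ _ _ = Pos-1
  TPBelow-bordered {N} {A} tp {suc k} r c r↑ c↑ c≤N
    with ℕ.m≤n⇒m<n∨m≡n (z≤n {r zero}) | ℕ.m≤n⇒m<n∨m≡n (z≤n {c zero})
  ... | inj₁ 0<r₀ | inj₁ 0<c₀ =
    bordered-positive-indices r c tp r↑ c↑
      (head-positive⇒positive r↑ 0<r₀) (head-positive⇒positive c↑ 0<c₀) c≤N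
  ... | inj₁ 0<r₀ | inj₂ 0≡c₀ =
    Pos-resp (sym (determinant-zero-column (submatrix (bordered A) r c) λ i →
      reflexive (bordered-zeroˡ A (head-positive⇒positive r↑ 0<r₀ i) (≡.sym 0≡c₀)))) Pos-0
  ... | inj₂ 0≡r₀ | c₀-cases =
    Pos-resp (sym (determinant-first-row (submatrix (bordered A) r c) λ j →
      reflexive (bordered-zeroʳ A (≡.sym 0≡r₀) (tail-positive c↑ j))))
      (Pos-* (corner≥0 c₀-cases)
        (bordered-positive-indices (r ∘ suc) (c ∘ suc) tp
          (strictlyIncreasing-tail r↑) (strictlyIncreasing-tail c↑)
          (tail-positive r↑) (tail-positive c↑) (c≤N ∘ suc)))
    where
    -- The corner is 1 if column 0 is selected as well, and 0 otherwise.
    corner≥0 : 0 < c zero ⊎ 0 ≡ c zero → Pos (bordered A (r zero) (c zero))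
    corner≥0 (inj₁ 0<c₀) = Pos-resp (sym (reflexive (bordered-zeroʳ A (≡.sym 0≡r₀) 0<c₀))) Pos-0
    corner≥0 (inj₂ 0≡c₀) = Pos-resp (reflexive (≡.cong₂ (bordered A) 0≡r₀ 0≡c₀)) Pos-1

  -- Rising and falling factorials, and Neville elimination of the Hankel matrix

  ν : ℕ → Carrier
  ν n = n ×ᴿ 1#

  ν-Pos : ∀ n → Pos (ν n)
  ν-Pos zero    = Pos-0
  ν-Pos (suc n) = Pos-+ Pos-1 (ν-Pos n)

  module RisingFactorials (x : Carrier) (x≥0 : Pos x) where

    -- x^k j(j−1)⋯(j−k+1)
    falling : ℕ → ℕ → Carrier
    falling zero    j       = 1#
    falling (suc k) zero    = 0#
    falling (suc k) (suc j) = ν (suc j) * x * falling k j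

    -- c(c+x)⋯(c+(n−1)x)
    rising : Carrier → ℕ → Carrier
    rising c zero    = 1#
    rising c (suc n) = c * rising (c + x) n

    -- falling (k+1) j = (j−k)x falling k j, without subtraction
    falling-sucˡ : ∀ k j → falling (suc k) j + ν k * x * falling k j ≈ ν j * x * falling k j
    falling-sucˡ zero    zero    = +-identityˡ _
    falling-sucˡ (suc k) zero    = trans (+-identityˡ _) (trans (zeroʳ _) (sym (zeroʳ _)))
    falling-sucˡ zero    (suc j) =
      solve 2 (λ w x → w :+ con 0 :* x :* con 1 := w) refl (ν (suc j) * x * 1#) x
    falling-sucˡ (suc k) (suc j) = begin
      w * falling (suc k) j + (1# + ν k) * x * (w * falling k j)
        ≈⟨ solve 5 (λ w g k x f → w :* g :+ (con 1 :+ k) :* x :* (w :* f) := w :* ((g :+ k :* x :* f) :+ x :* f))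
             refl w (falling (suc k) j) (ν k) x (falling k j) ⟩
      w * ((falling (suc k) j + ν k * x * falling k j) + x * falling k j)
        ≈⟨ *-congˡ (+-congʳ (falling-sucˡ k j)) ⟩
      w * (ν j * x * falling k j + x * falling k j)
        ≈⟨ solve 4 (λ w j x f → w :* (j :* x :* f :+ x :* f) := w :* ((con 1 :+ j) :* x :* f))
             refl w (ν j) x (falling k j) ⟩
      w * (w * falling k j) ∎
      where w = ν (suc j) * x

    -- Split the first factor: (j + 1)x = (k + 1)x + (j - k)x, and the second part turns
    -- `falling k j` into `falling (suc k) j`.
    falling-pascal : ∀ k j → falling (suc k) (suc j) ≈ ν (suc k) * x * falling k j + falling (suc k) j
    falling-pascal k j = begin
      (1# + ν j) * x * falling k j
        ≈⟨ solve 3 (λ j x f → (con 1 :+ j) :* x :* f := x :* f :+ j :* x :* f) refl (ν j) x (falling k j) ⟩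
      x * falling k j + ν j * x * falling k j
        ≈⟨ +-congˡ (falling-sucˡ k j) ⟨
      x * falling k j + (falling (suc k) j + ν k * x * falling k j)
        ≈⟨ solve 4 (λ k x f g → x :* f :+ (g :+ k :* x :* f) := (con 1 :+ k) :* x :* f :+ g)
             refl (ν k) x (falling k j) (falling (suc k) j) ⟩
      (1# + ν k) * x * falling k j + falling (suc k) j ∎

    falling-vanishes : ∀ {k j} → j < k → falling k j ≈ 0#
    falling-vanishes {suc k} {zero}  _         = refl
    falling-vanishes {suc k} {suc j} (s≤s j<k) = trans (*-congˡ (falling-vanishes j<k)) (zeroʳ _)

    -- `rising` peels off its first factor; the elimination and the recurrence for T_n(μ) need the
    -- last one.
    rising-last : ∀ c n → rising c (suc n) ≈ rising c n * (c + ν n * x)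
    rising-last c zero = solve 2 (λ c x → c :* con 1 := con 1 :* (c :+ con 0 :* x)) refl c x
    rising-last c (suc n) = begin
      c * rising (c + x) (suc n)
        ≈⟨ *-congˡ (rising-last (c + x) n) ⟩
      c * (rising (c + x) n * (c + x + ν n * x))
        ≈⟨ solve 4 (λ c r n x → c :* (r :* (c :+ x :+ n :* x)) := c :* r :* (c :+ (con 1 :+ n) :* x))
             refl c (rising (c + x) n) (ν n) x ⟩
      c * rising (c + x) n * (c + (1# + ν n) * x) ∎

    -- The upper triangular factor of the Hankel matrix of rising c.
    upper : Carrier → ℕ → ℕ → Carrier
    upper c k j = falling k j * rising c j

    -- By `falling-pascal`, row i of `upper c` combines rows i and i + 1 of the bordered
    -- `upper (c + x)`. The column shift absorbs the first factor of `rising c`, and the column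
    -- bound drops by one.
    upper-TPBelow : ∀ N c → Pos c → TPBelow N (upper c)
    upper-TPBelow zero    c c≥0 = TPBelow-zero (upper c)
    upper-TPBelow (suc N) c c≥0 =
      TPBelow-add-next α (always c) α≥0 (always c≥0) recurrence
        (TPBelow-bordered (upper-TPBelow N (c + x) (Pos-+ c≥0 x≥0)))
      where
      -- The coefficient of `falling-pascal` times the first factor `c` of `rising c`. Row 0 of `B`
      -- only supplies the entry 1 in column 0.
      α : ℕ → Carrier
      α zero    = 1#
      α (suc k) = ν (suc k) * x * c
      α≥0 : ∀ i → Pos (α i)
      α≥0 zero    = Pos-1
      α≥0 (suc k) = Pos-* (Pos-* (ν-Pos (suc k)) x≥0) c≥0
      B = bordered (upper (c + x))
      recurrence : ∀ i j → upper c i j ≈ α i * B i j + c * B (suc i) j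
      recurrence zero zero =
        solve 1 (λ c → con 1 :* con 1 := con 1 :* con 1 :+ c :* con 0) refl c
      recurrence zero (suc j) =
        solve 2 (λ c r → con 1 :* (c :* r) := con 1 :* con 0 :+ c :* (con 1 :* r)) refl c (rising (c + x) j)
      recurrence (suc k) zero =
        solve 2 (λ c w → con 0 :* con 1 := w :* con 0 :+ c :* con 0) refl c (α (suc k))
      recurrence (suc k) (suc j) = begin
        falling (suc k) (suc j) * (c * rising (c + x) j)
          ≈⟨ *-congʳ (falling-pascal k j) ⟩
        (ν (suc k) * x * falling k j + falling (suc k) j) * (c * rising (c + x) j)
          ≈⟨ solve 5 (λ w f g c r → (w :* f :+ g) :* (c :* r) := w :* c :* (f :* r) :+ c :* (g :* r))
               refl (ν (suc k) * x) (falling k j) (falling (suc k) j) c (rising (c + x) j) ⟩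
        ν (suc k) * x * c * (falling k j * rising (c + x) j) + c * (falling (suc k) j * rising (c + x) j) ∎

    -- The Hankel matrix of rising c after p rounds of Neville elimination.
    eliminated : Carrier → ℕ → ℕ → ℕ → Carrier
    eliminated c p m j = falling (p ⊓ m) j * rising c ((m ∸ p) ℕ.+ j)

    -- Round `p` leaves row m + 1 alone if m < p. Otherwise c + mx is the quotient of the entries of
    -- rows m + 1 and m in column `p`, which the round is to clear.
    multiplier : Carrier → ℕ → ℕ → Carrier
    multiplier c p m with m ℕ.<? p
    ... | yes _ = 0#
    ... | no _  = c + ν m * x

    multiplier-Pos : ∀ {c} → Pos c → ∀ p m → Pos (multiplier c p m)
    multiplier-Pos c≥0 p m with m ℕ.<? p
    ... | yes _ = Pos-0
    ... | no _  = Pos-+ c≥0 (Pos-* (ν-Pos m) x≥0)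

    -- For m = p + i, the last factor of `rising c (suc (i + j))` is c + (i + j)x = (j - p)x + (c +
    -- mx). The first summand turns `falling p j` into `falling (suc p) j`; the second is the
    -- multiplier.
    elimination-round : ∀ c p m j → eliminated c p (suc m) j ≈
      eliminated c (suc p) (suc m) j + multiplier c p m * eliminated c p m j
    elimination-round c p m j with m ℕ.<? p
    -- Both minima are m + 1 and both truncated differences are 0, so the row does not change.
    ... | yes m<p
      rewrite ℕ.m≥n⇒m⊓n≡n m<p | ℕ.m≥n⇒m⊓n≡n (ℕ.<⇒≤ m<p) | ℕ.m≤n⇒m∸n≡0 m<p | ℕ.m≤n⇒m∸n≡0 (ℕ.<⇒≤ m<p) =
      sym (trans (+-congˡ (zeroˡ _)) (+-identityʳ _))
    ... | no m≮p with ℕ.m≤n⇒∃[o]m+o≡n (ℕ.≮⇒≥ m≮p)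
    ...   | i , ≡.refl
      rewrite ℕ.m≤n⇒m⊓n≡m (ℕ.m≤m+n p i) | ℕ.m≤n⇒m⊓n≡m (ℕ.m≤n⇒m≤1+n (ℕ.m≤m+n p i))
            | ℕ.m+n∸m≡n p i | ≡.sym (ℕ.+-suc p i) | ℕ.m+n∸m≡n p (suc i) = begin
      falling p j * rising c (suc (i ℕ.+ j))
        ≈⟨ *-congˡ (rising-last c (i ℕ.+ j)) ⟩
      falling p j * (ρ * (c + ν (i ℕ.+ j) * x))
        ≈⟨ *-congˡ (*-congˡ (+-congˡ (*-congʳ (×-homo-+ 1# i j)))) ⟩
      falling p j * (ρ * (c + (ν i + ν j) * x))
        ≈⟨ solve 6 (λ f ρ c i j x → f :* (ρ :* (c :+ (i :+ j) :* x)) :=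
             (j :* x :* f) :* ρ :+ (c :+ i :* x) :* (f :* ρ)) refl (falling p j) ρ c (ν i) (ν j) x ⟩
      ν j * x * falling p j * ρ + (c + ν i * x) * (falling p j * ρ)
        ≈⟨ +-congʳ (*-congʳ (falling-sucˡ p j)) ⟨
      (falling (suc p) j + ν p * x * falling p j) * ρ + (c + ν i * x) * (falling p j * ρ)
        ≈⟨ solve 7 (λ f g ρ c i p x → (g :+ p :* x :* f) :* ρ :+ (c :+ i :* x) :* (f :* ρ) :=
             g :* ρ :+ (c :+ (p :+ i) :* x) :* (f :* ρ))
             refl (falling p j) (falling (suc p) j) ρ c (ν i) (ν p) x ⟩
      falling (suc p) j * ρ + (c + (ν p + ν i) * x) * (falling p j * ρ)
        ≈⟨ +-congˡ (*-congʳ (+-congˡ (*-congʳ (×-homo-+ 1# p i)))) ⟨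
      falling (suc p) j * ρ + (c + ν (p ℕ.+ i) * x) * (falling p j * ρ) ∎
      where ρ = rising c (i ℕ.+ j)

    -- The elimination run backwards: a round is undone from the top row down, each row receiving a
    -- multiple of the restored row above it.
    eliminated-TPBelow : ∀ N c → Pos c → ∀ p → TPBelow N (eliminated c p) → TPBelow N (eliminated c 0)
    eliminated-TPBelow N c c≥0 zero    tp = tp
    eliminated-TPBelow N c c≥0 (suc p) tp = eliminated-TPBelow N c c≥0 p
      (TPBelow-accumulate {B = eliminated c (suc p)} (multiplier c p) (multiplier-Pos c≥0 p) (first-row p) (elimination-round c p) tp)
      where
      first-row : ∀ p j → eliminated c p 0 j ≈ eliminated c (suc p) 0 j
      first-row zero    j = refl
      first-row (suc p) j = refl

    -- After `N` rounds, rows up to `N` have their final form; in rows from `N` on, both sides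
    -- vanish since j < N ≤ i.
    upper≈eliminated : ∀ N c i j → j < N → upper c i j ≈ eliminated c N i j
    upper≈eliminated N c i j j<N with ℕ.≤-total i N
    ... | inj₁ i≤N rewrite ℕ.m≥n⇒m⊓n≡n i≤N | ℕ.m≤n⇒m∸n≡0 i≤N = refl
    ... | inj₂ N≤i rewrite ℕ.m≤n⇒m⊓n≡m N≤i =
      trans (trans (*-congʳ (falling-vanishes (ℕ.<-≤-trans j<N N≤i))) (zeroˡ _))
        (sym (trans (*-congʳ (falling-vanishes j<N)) (zeroˡ _)))

    rising-Hankel-minor-Pos : ∀ c → Pos c → ∀ {k} (r s : Fin k → ℕ) →
      StrictlyIncreasing r → StrictlyIncreasing s →
      Pos (determinant (submatrix (λ i j → rising c (i ℕ.+ j)) r s))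
    rising-Hankel-minor-Pos c c≥0 r s r↑ s↑ =
      -- `falling 0 j` is 1, so round 0 is the Hankel matrix itself.
      Pos-resp (determinant-cong {M = submatrix (eliminated c 0) r s} λ i j → *-identityˡ _)
        (eliminated-TPBelow N c c≥0 N
          (TPBelow-cong (upper≈eliminated N c) (upper-TPBelow N c c≥0))
          r s r↑ s↑ (proj₂ (bounded s)))
      -- The bound on the selected columns also serves as the number of rounds.
      where N = proj₁ (bounded s)

-- Ring identities behind the recurrence at q = μ

module RowSumIdentities {a ℓ : Level} (R : CommutativeRing a ℓ) where
  open CommutativeRing R hiding (zero)
  open Algebra.Solver.Ring.NaturalCoefficients.Default commutativeSemiring
  open Relation.Binary.Reasoning.Setoid setoid

  telescoping-base : ∀ A a₂ B b₁ b₂ μ t e →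
    (A + a₂) * t * e + (B + b₁ * 1# + b₂) * (μ * (t * e)) ≈ (A + a₂ + μ * (B + b₁ + b₂)) * (t * e)
  telescoping-base = solve 8 (λ A a₂ B b₁ b₂ μ t e →
    (A :+ a₂) :* t :* e :+ (B :+ b₁ :* con 1 :+ b₂) :* (μ :* (t :* e)) :=
    (A :+ a₂ :+ μ :* (B :+ b₁ :+ b₂)) :* (t :* e)) refl

  -- The old remainder is the part of the new term that comes from `t`. In the new remainder b₁(k +
  -- 1) loses b₁k to the summand -μb₁k of the new term. `k′` is kept apart because `natP (suc n)`
  -- and `oneP ⊕ natP n` are different lists with equal coefficients.
  telescoping-step : ∀ A a₂ B b₁ b₂ μ k t t′ e L s {k′} → k′ ≈ 1# + k →
    L + (B + b₁ * k + b₂) * (μ * (t * e)) ≈ (A + a₂ + μ * (B + b₁ + b₂)) * s →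
    L + ((A + - (μ * b₁ * k) + a₂) * t′ + (B + b₁ * k + b₂) * t) * (μ * e)
      + (B + b₁ * k′ + b₂) * (μ * (t′ * (μ * e)))
      ≈ (A + a₂ + μ * (B + b₁ + b₂)) * (s + t′ * (μ * e))
  telescoping-step A a₂ B b₁ b₂ μ k t t′ e L s {k′} k′≈1+k hyp = begin
    L + ((A + - w + a₂) * t′ + (B + b₁ * k + b₂) * t) * (μ * e) + (B + b₁ * k′ + b₂) * (μ * (t′ * (μ * e)))
      ≈⟨ +-congˡ (*-congʳ (+-congʳ (+-congˡ (*-congˡ k′≈1+k)))) ⟩
    L + ((A + - w + a₂) * t′ + (B + b₁ * k + b₂) * t) * (μ * e) + (B + b₁ * (1# + k) + b₂) * (μ * (t′ * (μ * e)))
      -- -w is one variable here: the solver knows semirings only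
      ≈⟨ solve 12 (λ L A -w a₂ B b₁ b₂ μ k t t′ e →
           L :+ ((A :+ -w :+ a₂) :* t′ :+ (B :+ b₁ :* k :+ b₂) :* t) :* (μ :* e)
             :+ (B :+ b₁ :* (con 1 :+ k) :+ b₂) :* (μ :* (t′ :* (μ :* e))) :=
           (L :+ (B :+ b₁ :* k :+ b₂) :* (μ :* (t :* e)))
             :+ (A :+ a₂ :+ μ :* (B :+ b₁ :+ b₂)) :* (t′ :* (μ :* e))
             :+ (-w :+ μ :* b₁ :* k) :* (t′ :* (μ :* e)))
           refl L A (- w) a₂ B b₁ b₂ μ k t t′ e ⟩
    (L + (B + b₁ * k + b₂) * (μ * (t * e))) + κ * (t′ * (μ * e)) + (- w + w) * (t′ * (μ * e))
      ≈⟨ +-cong (+-congʳ hyp) (trans (*-congʳ (-‿inverseˡ w)) (zeroˡ _)) ⟩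
    κ * s + κ * (t′ * (μ * e)) + 0#
      ≈⟨ +-identityʳ _ ⟩
    κ * s + κ * (t′ * (μ * e))
      ≈⟨ distribˡ κ s _ ⟨
    κ * (s + t′ * (μ * e)) ∎
    where
    w = μ * b₁ * k
    κ = A + a₂ + μ * (B + b₁ + b₂)

  -- For v = n this reads x(n + 1) + y = c + nx.
  ratio-identity : ∀ a₀ a₂ b₀ b₁ b₂ μ v →
    a₀ * (1# + v) + a₂ + μ * (b₀ * (1# + v) + b₁ + b₂) ≈
    a₀ + μ * b₀ + (a₂ + μ * (b₁ + b₂)) + v * (a₀ + μ * b₀)
  ratio-identity = solve 7 (λ a₀ a₂ b₀ b₁ b₂ μ v →
    a₀ :* (con 1 :+ v) :+ a₂ :+ μ :* (b₀ :* (con 1 :+ v) :+ b₁ :+ b₂) :=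
    a₀ :+ μ :* b₀ :+ (a₂ :+ μ :* (b₁ :+ b₂)) :+ v :* (a₀ :+ μ :* b₀)) refl

-- The commutative ring of polynomials up to equality of coefficients

infix 4 _≃_
-- A record keeps `p` and `q` inferable from the type, which unification could not recover from
-- values of `coeff`.
record _≃_ (p q : Poly) : Set where
  constructor equal-coefficients
  field at : ∀ m → coeff p m ≡ coeff q m
open _≃_

coeff-here : ∀ c {e m} p → e ≡ m → coeff ((c , e) ∷ p) m ≡ c ℤ.+ coeff p m
coeff-here c {e} {m} p e≡m with ≡-dec ℕ._≟_ e m
... | yes _  = ≡.refl
... | no e≢m = contradiction e≡m e≢m

coeff-there : ∀ c {e m} p → e ≢ m → coeff ((c , e) ∷ p) m ≡ coeff p m
coeff-there c {e} {m} p e≢m with ≡-dec ℕ._≟_ e m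
... | yes e≡m = contradiction e≡m e≢m
... | no _    = ≡.refl

coeff-⊕ : ∀ p q m → coeff (p ⊕ q) m ≡ coeff p m ℤ.+ coeff q m
coeff-⊕ [] q m = ≡.sym (ℤ.+-identityˡ _)
coeff-⊕ ((c , e) ∷ p) q m with ≡-dec ℕ._≟_ e m
... | yes _ = ≡.trans (≡.cong (ℤ._+_ c) (coeff-⊕ p q m)) (≡.sym (ℤ.+-assoc c _ _))
... | no _  = coeff-⊕ p q m

coeff-neg : ∀ p m → coeff (neg p) m ≡ ℤ.- coeff p m
coeff-neg [] m = ≡.refl
coeff-neg ((c , e) ∷ p) m with ≡-dec ℕ._≟_ e m
... | yes _ = ≡.trans (≡.cong (ℤ._+_ (ℤ.- c)) (coeff-neg p m)) (≡.sym (ℤ.neg-distrib-+ c _))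
... | no _  = coeff-neg p m

≃-refl : ∀ {p} → p ≃ p
≃-refl .at m = ≡.refl

≃-reflexive : ∀ {p q} → p ≡ q → p ≃ q
≃-reflexive ≡.refl = ≃-refl

≃-sym : ∀ {p q} → p ≃ q → q ≃ p
≃-sym p≃q .at m = ≡.sym (p≃q .at m)

≃-trans : ∀ {p q r} → p ≃ q → q ≃ r → p ≃ r
≃-trans p≃q q≃r .at m = ≡.trans (p≃q .at m) (q≃r .at m)

⊕-cong : ∀ {p p′ q q′} → p ≃ p′ → q ≃ q′ → p ⊕ q ≃ p′ ⊕ q′
⊕-cong {p} {p′} {q} {q′} p≃p′ q≃q′ .at m
  rewrite coeff-⊕ p q m | coeff-⊕ p′ q′ m = ≡.cong₂ ℤ._+_ (p≃p′ .at m) (q≃q′ .at m)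

⊕-comm : ∀ p q → p ⊕ q ≃ q ⊕ p
⊕-comm p q .at m rewrite coeff-⊕ p q m | coeff-⊕ q p m = ℤ.+-comm (coeff p m) (coeff q m)

neg-cong : ∀ {p q} → p ≃ q → neg p ≃ neg q
neg-cong {p} {q} p≃q .at m rewrite coeff-neg p m | coeff-neg q m = ≡.cong ℤ.-_ (p≃q .at m)

neg-inverseʳ : ∀ p → p ⊕ neg p ≃ zeroP
neg-inverseʳ p .at m rewrite coeff-⊕ p (neg p) m | coeff-neg p m = ℤ.+-inverseʳ (coeff p m)

⊕-isAbelianGroup : IsAbelianGroup _≃_ _⊕_ zeroP neg
⊕-isAbelianGroup = record
  { isGroup = record
    { isMonoid = record
      { isSemigroup = record
        { isMagma = record
          { isEquivalence = record { refl = ≃-refl ; sym = ≃-sym ; trans = ≃-trans }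
          ; ∙-cong = ⊕-cong
          }
        ; assoc = λ p q r → ≃-reflexive (List.++-assoc p q r)
        }
      ; identity = (λ p → ≃-refl) , (λ p → ≃-reflexive (List.++-identityʳ p))
      }
    ; inverse = (λ p → ≃-trans (⊕-comm (neg p) p) (neg-inverseʳ p)) , neg-inverseʳ
    ; ⁻¹-cong = neg-cong
    }
  ; comm = ⊕-comm
  }

≃-setoid : Setoid _ _
≃-setoid = record { isEquivalence = IsAbelianGroup.isEquivalence ⊕-isAbelianGroup }

module ≃-Reasoning = Relation.Binary.Reasoning.Setoid ≃-setoid

Term : Set
Term = ℤ × Monomial

_·_ : Term → Term → Term
(c , e) · (d , f) = c ℤ.* d , zipWith ℕ._+_ e f

·-assoc : ∀ s t u → (s · t) · u ≡ s · (t · u)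
·-assoc (c , e) (d , f) (b , g) = ≡.cong₂ _,_ (ℤ.*-assoc c d b) (Vec.zipWith-assoc ℕ.+-assoc e f g)

·-comm : ∀ s t → s · t ≡ t · s
·-comm (c , e) (d , f) = ≡.cong₂ _,_ (ℤ.*-comm c d) (Vec.zipWith-comm ℕ.+-comm e f)

·-identityˡ : ∀ t → (1ℤ , replicate 6 0) · t ≡ t
·-identityˡ (c , e) = ≡.cong₂ _,_ (ℤ.*-identityˡ c) (Vec.zipWith-identityˡ ℕ.+-identityˡ e)

scale : Term → Poly → Poly
scale t = List.map (t ·_)

∷-⊗ : ∀ t p q → (t ∷ p) ⊗ q ≡ scale t q ⊕ p ⊗ q
∷-⊗ t p q = ≡.cong (_⊕ p ⊗ q) (List.map-cong (λ _ → ≡.refl) q)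

-- The cofactor is determined by the product, so multiplication by a monomial is injective on
-- monomials.
+-∸-cancel : ∀ {n} {e f m : Vec ℕ n} → zipWith ℕ._+_ e f ≡ m → f ≡ zipWith _∸_ m e
+-∸-cancel {e = []} {[]} ≡.refl = ≡.refl
+-∸-cancel {e = x ∷ e} {y ∷ f} ≡.refl = ≡.cong₂ _∷_ (≡.sym (ℕ.m+n∸m≡n x y)) (+-∸-cancel ≡.refl)

coeff-scale-multiple : ∀ c {e f} q → coeff (scale (c , e) q) (zipWith ℕ._+_ e f) ≡ c ℤ.* coeff q f
coeff-scale-multiple c [] = ≡.sym (ℤ.*-zeroʳ c)
coeff-scale-multiple c {e} {f} ((d , g) ∷ q) with ≡-dec ℕ._≟_ g f
... | yes ≡.refl = ≡.trans (coeff-here (c ℤ.* d) (scale (c , e) q) ≡.refl)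
  (≡.trans (≡.cong (ℤ._+_ (c ℤ.* d)) (coeff-scale-multiple c q)) (≡.sym (ℤ.*-distribˡ-+ c d _)))
... | no g≢f = ≡.trans (coeff-there (c ℤ.* d) (scale (c , e) q)
    (λ eq → g≢f (≡.trans (+-∸-cancel {e = e} eq) (≡.sym (+-∸-cancel {e = e} ≡.refl)))))
  (coeff-scale-multiple c q)

coeff-scale-nonmultiple : ∀ c {e m} q → (∀ f → zipWith ℕ._+_ e f ≢ m) → coeff (scale (c , e) q) m ≡ 0ℤ
coeff-scale-nonmultiple c [] _ = ≡.refl
coeff-scale-nonmultiple c {e} ((d , g) ∷ q) e∤m =
  ≡.trans (coeff-there (c ℤ.* d) (scale (c , e) q) (e∤m g)) (coeff-scale-nonmultiple c q e∤m)

scale-cong : ∀ t {p q} → p ≃ q → scale t p ≃ scale t q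
-- m ∸ e is the only possible cofactor, so one decidable equation tells whether `e` divides `m`; if
-- not, both coefficients are 0.
scale-cong (c , e) {p} {q} p≃q .at m with ≡-dec ℕ._≟_ (zipWith ℕ._+_ e (zipWith _∸_ m e)) m
... | yes eq = ≡.subst (λ m → coeff (scale (c , e) p) m ≡ coeff (scale (c , e) q) m) eq
  (≡.trans (coeff-scale-multiple c p)
    (≡.trans (≡.cong (ℤ._*_ c) (p≃q .at _)) (≡.sym (coeff-scale-multiple c q))))
... | no neq = ≡.trans (coeff-scale-nonmultiple c p e∤m) (≡.sym (coeff-scale-nonmultiple c q e∤m))
  where
  e∤m : ∀ f → zipWith ℕ._+_ e f ≢ m
  e∤m f eq = neq (≡.trans (≡.cong (zipWith ℕ._+_ e) (≡.sym (+-∸-cancel {e = e} eq))) eq)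

⊗-congʳ : ∀ p {q r} → q ≃ r → p ⊗ q ≃ p ⊗ r
⊗-congʳ []      q≃r = ≃-refl
⊗-congʳ (t ∷ p) {q} {r} q≃r = begin
  (t ∷ p) ⊗ q          ≡⟨ ∷-⊗ t p q ⟩
  scale t q ⊕ p ⊗ q    ≈⟨ ⊕-cong (scale-cong t q≃r) (⊗-congʳ p q≃r) ⟩
  scale t r ⊕ p ⊗ r    ≡⟨ ∷-⊗ t p r ⟨
  (t ∷ p) ⊗ r          ∎
  where open ≃-Reasoning

⊗-distribʳ : ∀ r p q → (p ⊕ q) ⊗ r ≡ p ⊗ r ⊕ q ⊗ r
⊗-distribʳ r [] q = ≡.refl
⊗-distribʳ r (t ∷ p) q = begin
  (t ∷ p ⊕ q) ⊗ r                ≡⟨ ∷-⊗ t (p ⊕ q) r ⟩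
  scale t r ⊕ (p ⊕ q) ⊗ r        ≡⟨ ≡.cong (scale t r ⊕_) (⊗-distribʳ r p q) ⟩
  scale t r ⊕ (p ⊗ r ⊕ q ⊗ r)    ≡⟨ List.++-assoc (scale t r) (p ⊗ r) (q ⊗ r) ⟨
  (scale t r ⊕ p ⊗ r) ⊕ q ⊗ r    ≡⟨ ≡.cong (_⊕ q ⊗ r) (∷-⊗ t p r) ⟨
  (t ∷ p) ⊗ r ⊕ q ⊗ r            ∎
  where open ≡.≡-Reasoning

⊗-zeroʳ : ∀ p → p ⊗ zeroP ≡ zeroP
⊗-zeroʳ []      = ≡.refl
⊗-zeroʳ (t ∷ p) = ⊗-zeroʳ p

-- `_⊗_` recurses on its left factor. Unfolding the right one lists the same terms in another order,
-- hence `≃`; commutativity follows by induction.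
⊗-∷ : ∀ p t q → p ⊗ (t ∷ q) ≃ scale t p ⊕ p ⊗ q
⊗-∷ [] t q = ≃-refl
⊗-∷ (s ∷ p) t q = begin
  (s ∷ p) ⊗ (t ∷ q)
    ≡⟨ ∷-⊗ s p (t ∷ q) ⟩
  (s · t ∷ []) ⊕ (scale s q ⊕ p ⊗ (t ∷ q))
    ≈⟨ ⊕-cong (≃-reflexive (≡.cong (_∷ []) (·-comm s t))) (⊕-cong (≃-refl {scale s q}) (⊗-∷ p t q)) ⟩
  (t · s ∷ []) ⊕ (scale s q ⊕ (scale t p ⊕ p ⊗ q))
    ≈⟨ ⊕-cong (≃-refl {t · s ∷ []}) (begin
         scale s q ⊕ (scale t p ⊕ p ⊗ q)    ≡⟨ List.++-assoc (scale s q) (scale t p) (p ⊗ q) ⟨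
         (scale s q ⊕ scale t p) ⊕ p ⊗ q    ≈⟨ ⊕-cong (⊕-comm (scale s q) (scale t p)) ≃-refl ⟩
         (scale t p ⊕ scale s q) ⊕ p ⊗ q    ≡⟨ List.++-assoc (scale t p) (scale s q) (p ⊗ q) ⟩
         scale t p ⊕ (scale s q ⊕ p ⊗ q)    ∎) ⟩
  scale t (s ∷ p) ⊕ (scale s q ⊕ p ⊗ q)
    ≡⟨ ≡.cong (scale t (s ∷ p) ⊕_) (∷-⊗ s p q) ⟨
  scale t (s ∷ p) ⊕ (s ∷ p) ⊗ q ∎
  where open ≃-Reasoning

⊗-comm : ∀ p q → p ⊗ q ≃ q ⊗ p
⊗-comm [] q = ≃-reflexive (≡.sym (⊗-zeroʳ q))
⊗-comm (t ∷ p) q = begin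
  (t ∷ p) ⊗ q          ≡⟨ ∷-⊗ t p q ⟩
  scale t q ⊕ p ⊗ q    ≈⟨ ⊕-cong (≃-refl {scale t q}) (⊗-comm p q) ⟩
  scale t q ⊕ q ⊗ p    ≈⟨ ⊗-∷ q t p ⟨
  q ⊗ (t ∷ p)          ∎
  where open ≃-Reasoning

scale-⊗ : ∀ t p q → scale t p ⊗ q ≡ scale t (p ⊗ q)
scale-⊗ t [] q = ≡.refl
scale-⊗ t (s ∷ p) q = begin
  scale t (s ∷ p) ⊗ q                    ≡⟨ ∷-⊗ (t · s) (scale t p) q ⟩
  scale (t · s) q ⊕ scale t p ⊗ q        ≡⟨ ≡.cong₂ _⊕_ (List.map-cong (·-assoc t s) q) (scale-⊗ t p q) ⟩
  List.map (λ u → t · (s · u)) q ⊕ scale t (p ⊗ q)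
                                         ≡⟨ ≡.cong (_⊕ scale t (p ⊗ q)) (List.map-∘ q) ⟩
  scale t (scale s q) ⊕ scale t (p ⊗ q)  ≡⟨ List.map-++ (t ·_) (scale s q) (p ⊗ q) ⟨
  scale t (scale s q ⊕ p ⊗ q)            ≡⟨ ≡.cong (scale t) (∷-⊗ s p q) ⟨
  scale t ((s ∷ p) ⊗ q)                  ∎
  where open ≡.≡-Reasoning

⊗-assoc : ∀ p q r → (p ⊗ q) ⊗ r ≡ p ⊗ (q ⊗ r)
⊗-assoc [] q r = ≡.refl
⊗-assoc (t ∷ p) q r = begin
  (t ∷ p) ⊗ q ⊗ r                    ≡⟨ ≡.cong (_⊗ r) (∷-⊗ t p q) ⟩
  (scale t q ⊕ p ⊗ q) ⊗ r            ≡⟨ ⊗-distribʳ r (scale t q) (p ⊗ q) ⟩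
  scale t q ⊗ r ⊕ p ⊗ q ⊗ r          ≡⟨ ≡.cong₂ _⊕_ (scale-⊗ t q r) (⊗-assoc p q r) ⟩
  scale t (q ⊗ r) ⊕ p ⊗ (q ⊗ r)      ≡⟨ ∷-⊗ t p (q ⊗ r) ⟨
  (t ∷ p) ⊗ (q ⊗ r)                  ∎
  where open ≡.≡-Reasoning

⊗-identityˡ : ∀ p → oneP ⊗ p ≡ p
⊗-identityˡ p = ≡.trans (∷-⊗ (1ℤ , replicate 6 0) [] p)
  (≡.trans (List.++-identityʳ (scale (1ℤ , replicate 6 0) p)) (≡.trans (List.map-cong ·-identityˡ p) (List.map-id p)))

polyRing : CommutativeRing _ _
polyRing = record
  { Carrier = Poly ; _≈_ = _≃_ ; _+_ = _⊕_ ; _*_ = _⊗_ ; -_ = neg ; 0# = zeroP ; 1# = oneP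
  ; isCommutativeRing = record
    { isRing = record
      { +-isAbelianGroup = ⊕-isAbelianGroup
      ; *-cong = λ {p} {p′} {q} {q′} p≃p′ q≃q′ → ≃-trans (⊗-congʳ p q≃q′)
          (≃-trans (⊗-comm p q′) (≃-trans (⊗-congʳ q′ p≃p′) (⊗-comm q′ p′)))
      ; *-assoc = λ p q r → ≃-reflexive (⊗-assoc p q r)
      ; *-identity = (λ p → ≃-reflexive (⊗-identityˡ p)) ,
          (λ p → ≃-trans (⊗-comm p oneP) (≃-reflexive (⊗-identityˡ p)))
      ; distrib =
          (λ p q r → ≃-trans (⊗-comm p (q ⊕ r)) (≃-trans (≃-reflexive (⊗-distribʳ p q r))
            (⊕-cong (⊗-comm q p) (⊗-comm r p)))) ,
          (λ r p q → ≃-reflexive (⊗-distribʳ r p q))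
      }
    ; *-comm = ⊗-comm
    }
  }

-- The cone of polynomials with nonnegative coefficients

NonNegTerms : Poly → Set
NonNegTerms = All (λ t → 0ℤ ℤ.≤ proj₁ t)

NonNegTerms⇒NonNeg : ∀ {p} → NonNegTerms p → NonNeg p
NonNegTerms⇒NonNeg [] m = ℤ.≤-refl
NonNegTerms⇒NonNeg {(c , e) ∷ p} (c≥0 ∷ p≥0) m with ≡-dec ℕ._≟_ e m
... | yes _ = ℤ.+-mono-≤ c≥0 (NonNegTerms⇒NonNeg p≥0 m)
... | no _  = NonNegTerms⇒NonNeg p≥0 m

*-nonNeg : ∀ {i j} → 0ℤ ℤ.≤ i → 0ℤ ℤ.≤ j → 0ℤ ℤ.≤ i ℤ.* j
*-nonNeg {+ m} {+ n} _ _ = ≡.subst (0ℤ ℤ.≤_) (ℤ.pos-* m n) (ℤ.+≤+ z≤n)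

scale-nonNegTerms : ∀ {t q} → 0ℤ ℤ.≤ proj₁ t → NonNegTerms q → NonNegTerms (scale t q)
scale-nonNegTerms t≥0 []          = []
scale-nonNegTerms t≥0 (s≥0 ∷ q≥0) = *-nonNeg t≥0 s≥0 ∷ scale-nonNegTerms t≥0 q≥0

⊗-nonNegTerms : ∀ {p q} → NonNegTerms p → NonNegTerms q → NonNegTerms (p ⊗ q)
⊗-nonNegTerms [] _ = []
⊗-nonNegTerms {t ∷ p} {q} (t≥0 ∷ p≥0) q≥0 = ≡.subst NonNegTerms (≡.sym (∷-⊗ t p q))
  (All.++⁺ (scale-nonNegTerms t≥0 q≥0) (⊗-nonNegTerms p≥0 q≥0))

-- Products of lists with nonnegative terms have nonnegative terms, whereas NonNeg says nothing
-- about the individual terms of a list.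
polyCone : PositiveCone polyRing _
polyCone = record
  { Pos      = λ p → ∃ λ q → p ≃ q × NonNegTerms q
  ; Pos-resp = λ { u≃v (q , u≃q , q≥0) → q , ≃-trans (≃-sym u≃v) u≃q , q≥0 }
  ; Pos-0    = zeroP , ≃-refl , []
  ; Pos-1    = oneP , ≃-refl , ℤ.+≤+ z≤n ∷ []
  ; Pos-+    = λ { (p , u≃p , p≥0) (q , v≃q , q≥0) → p ⊕ q , ⊕-cong u≃p v≃q , All.++⁺ p≥0 q≥0 }
  ; Pos-*    = λ { (p , u≃p , p≥0) (q , v≃q , q≥0) →
      p ⊗ q , CommutativeRing.*-cong polyRing u≃p v≃q , ⊗-nonNegTerms p≥0 q≥0 }
  }

-- Passage from the given determinant, signs and constants to those of the ring

open PositiveCone polyCone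
open CommutativeRing polyRing 
  using (ring; semiring; *-cong; *-congʳ; +-congˡ; zeroˡ; zeroʳ; *-identityˡ)
open Algebra.Properties.Ring ring using (-‿distribˡ-*; -‿involutive)
open Algebra.Properties.Semiring.Sum semiring using (sum)
open Determinant polyRing using (sgn; determinant; determinant-cong; Matrix)
open Positivity polyRing polyCone using (ν; module RisingFactorials)
open RowSumIdentities polyRing

Pos-var : ∀ i → Pos (var i)
Pos-var i = var i , ≃-refl , ℤ.+≤+ z≤n ∷ []

natP-suc : ∀ n → natP (suc n) ≃ oneP ⊕ natP n
natP-suc n .at m with ≡-dec ℕ._≟_ (replicate 6 0) m
... | yes eq = ≡.trans (ℤ.+-assoc 1ℤ (+ n) 0ℤ) (≡.cong (ℤ._+_ 1ℤ) (≡.sym (coeff-here (+ n) [] eq)))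
... | no neq = ≡.sym (coeff-there (+ n) [] neq)

natP≃ν : ∀ n → natP n ≃ ν n
natP≃ν zero .at m with ≡-dec ℕ._≟_ (replicate 6 0) m
... | yes _ = ≡.refl
... | no _  = ≡.refl
natP≃ν (suc n) = ≃-trans (natP-suc n) (⊕-cong (≃-refl {oneP}) (natP≃ν n))

Pos⇒NonNeg : ∀ {p} → Pos p → NonNeg p
Pos⇒NonNeg (q , p≃q , q≥0) m = ≡.subst (0ℤ ℤ.≤_) (≡.sym (p≃q .at m)) (NonNegTerms⇒NonNeg q≥0 m)

signP≃sgn : ∀ n p → signP n p ≃ sgn n ⊗ p
signP≃sgn zero p = ≃-sym (*-identityˡ p)
signP≃sgn (suc zero) p = ≃-trans (neg-cong (≃-sym (*-identityˡ p))) (-‿distribˡ-* oneP p)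
-- `signP` descends by two, so a double negation in `sgn` has to be removed.
signP≃sgn (suc (suc n)) p =
  ≃-trans (signP≃sgn n p) (*-congʳ {p} (≃-sym (-‿involutive (sgn n))))

sumFin≃sum : ∀ {k} {f g : Fin k → Poly} → (∀ j → f j ≃ g j) → sumFin f ≃ sum g
sumFin≃sum {zero}  f≃g = ≃-refl
sumFin≃sum {suc k} f≃g = ⊕-cong (f≃g zero) (sumFin≃sum (f≃g ∘ suc))

det≃determinant : ∀ {k} (M : Matrix k) → det M ≃ determinant M
det≃determinant {zero}  M = ≃-refl
det≃determinant {suc k} M = sumFin≃sum λ j →
  ≃-trans (signP≃sgn (toℕ j) _)
    (⊗-congʳ (sgn (toℕ j)) (⊗-congʳ (M zero j) (det≃determinant (λ r c → M (suc r) (punchIn j c)))))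

-- The recurrence for T_n(μ)

T-vanishes : ∀ {n k} → n < k → T n k ≃ zeroP
T-vanishes {zero}  {suc k} _         = ≃-refl
T-vanishes {suc n} {suc k} (s≤s n<k) = ⊕-cong
  (≃-trans (⊗-congʳ left (T-vanishes (ℕ.m<n⇒m<1+n n<k))) (zeroʳ left))
  (≃-trans (⊗-congʳ right (T-vanishes n<k)) (zeroʳ right))
  where
  left  = a₀ ⊗ natP (suc n) ⊖ μ ⊗ b₁ ⊗ natP (suc k) ⊕ a₂
  right = b₀ ⊗ natP (suc n) ⊕ b₁ ⊗ natP (suc k) ⊕ b₂

-- The factor from T_{n-1}(μ) to T_n(μ), with a polynomial `N` for n so that `natP n` can be
-- exchanged for `ν n`.
ratio : Poly → Poly
ratio N = a₀ ⊗ N ⊕ a₂ ⊕ μ ⊗ (b₀ ⊗ N ⊕ b₁ ⊕ b₂)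

rowSum : ℕ → ℕ → Poly
rowSum n K = sumP K (λ k → T n k ⊗ (μ ^P k))

-- The contribution of T_{n,K} to the term k = K + 1 of T_{n+1}(μ). It completes the contributions
-- of T_{n,0}, ..., T_{n,K}.
remainder : ℕ → ℕ → Poly
remainder n K = (b₀ ⊗ natP (suc n) ⊕ b₁ ⊗ natP (suc K) ⊕ b₂) ⊗ (μ ⊗ (T n K ⊗ (μ ^P K)))

-- Inside a row sum at q = μ, the terms - μ b₁ k and + b₁ k of the recurrence cancel between
-- consecutive k, up to a boundary remainder.
rowSum-telescopes : ∀ n K →
  rowSum (suc n) (suc K) ⊕ remainder n K ≃ ratio (natP (suc n)) ⊗ rowSum n (suc K)
rowSum-telescopes n zero =
  telescoping-base (a₀ ⊗ natP (suc n)) a₂ (b₀ ⊗ natP (suc n)) b₁ b₂ μ (T n 0) oneP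
rowSum-telescopes n (suc K) =
  telescoping-step (a₀ ⊗ natP (suc n)) a₂ (b₀ ⊗ natP (suc n)) b₁ b₂ μ
    (natP (suc K)) (T n K) (T n (suc K)) (μ ^P K)
    (rowSum (suc n) (suc K)) (rowSum n (suc K)) (natP-suc (suc K)) (rowSum-telescopes n K)

Tμ-suc : ∀ n → Tμ (suc n) ≃ ratio (natP (suc n)) ⊗ Tμ n
Tμ-suc n = begin
  Tμ (suc n)                                              ≡⟨ List.++-identityʳ _ ⟨
  Tμ (suc n) ⊕ zeroP                                      ≈⟨ +-congˡ {Tμ (suc n)} remainder≃0 ⟨
  -- At K = n + 1 the left sum is all of T_{n+1}(μ); the remainder and the surplus term on the right
  -- both contain T_{n,n+1} = 0.
  Tμ (suc n) ⊕ remainder n (suc n)                        ≈⟨ rowSum-telescopes n (suc n) ⟩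
  ratio (natP (suc n)) ⊗ (Tμ n ⊕ T n (suc n) ⊗ (μ ^P suc n))
    ≈⟨ ⊗-congʳ (ratio (natP (suc n))) (+-congˡ {Tμ n} term≃0) ⟩
  ratio (natP (suc n)) ⊗ (Tμ n ⊕ zeroP)
    ≡⟨ ≡.cong (ratio (natP (suc n)) ⊗_) (List.++-identityʳ (Tμ n)) ⟩
  ratio (natP (suc n)) ⊗ Tμ n                             ∎
  where
  open ≃-Reasoning
  term≃0 : T n (suc n) ⊗ (μ ^P suc n) ≃ zeroP
  term≃0 = ≃-trans (*-congʳ {μ ^P suc n} (T-vanishes (ℕ.n<1+n n))) (zeroˡ (μ ^P suc n))
  factor = b₀ ⊗ natP (suc n) ⊕ b₁ ⊗ natP (suc (suc n)) ⊕ b₂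
  remainder≃0 : remainder n (suc n) ≃ zeroP
  remainder≃0 = ≃-trans (⊗-congʳ factor (≃-trans (⊗-congʳ μ term≃0) (zeroʳ μ))) (zeroʳ factor)

-- T_n(μ) as a rising factorial, and total positivity

increment : Poly
increment = a₀ ⊕ μ ⊗ b₀

-- The factor at n = 1, where the recurrence starts; hence it already contains one `increment`.
base : Poly
base = increment ⊕ (a₂ ⊕ μ ⊗ (b₁ ⊕ b₂))

increment≥0 : Pos increment
increment≥0 = Pos-+ (Pos-var 0F) (Pos-* (Pos-var 5F) (Pos-var 2F))

base≥0 : Pos base
base≥0 = Pos-+ increment≥0 (Pos-+ (Pos-var 1F) (Pos-* (Pos-var 5F) (Pos-+ (Pos-var 3F) (Pos-var 4F))))

open RisingFactorials increment increment≥0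

ratio-cong : ∀ {N N′} → N ≃ N′ → ratio N ≃ ratio N′
ratio-cong {N} {N′} N≃N′ = ⊕-cong
  (⊕-cong (⊗-congʳ a₀ N≃N′) (≃-refl {a₂}))
  (⊗-congʳ μ (⊕-cong (⊕-cong (⊗-congʳ b₀ N≃N′) (≃-refl {b₁})) (≃-refl {b₂})))

Tμ≃rising : ∀ n → Tμ n ≃ rising base n
Tμ≃rising zero = ≃-refl
Tμ≃rising (suc n) = begin
  Tμ (suc n)
    ≈⟨ Tμ-suc n ⟩
  ratio (natP (suc n)) ⊗ Tμ n
    ≈⟨ *-cong (≃-trans (ratio-cong (natP≃ν (suc n))) (ratio-identity a₀ a₂ b₀ b₁ b₂ μ (ν n))) (Tμ≃rising n) ⟩
  (base ⊕ ν n ⊗ increment) ⊗ rising base n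
    ≈⟨ ⊗-comm (base ⊕ ν n ⊗ increment) (rising base n) ⟩
  rising base n ⊗ (base ⊕ ν n ⊗ increment)
    ≈⟨ rising-last base n ⟨
  rising base (suc n) ∎
  where open ≃-Reasoning

theorem1p8 : StieltjesMoment Tμ
theorem1p8 k r c r↑ c↑ = Pos⇒NonNeg
  -- `Pos` respects `≃`, so it passes from the determinant in rising factorials to `det` of the
  -- Hankel matrix of `Tμ`.
  (Pos-resp (≃-sym (≃-trans (det≃determinant (λ i j → Hankel Tμ (r i) (c j)))
      (determinant-cong λ i j → Tμ≃rising (r i ℕ.+ c j))))
    (rising-Hankel-minor-Pos base base≥0 r c r↑ c↑))
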